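{- Let $0\leq\varepsilon_c<\varepsilon_f\leq1$, $g=\varepsilon_f-\varepsilon_c$, and $\delta\in(0,1/4)$. Protocol $\Pi_{\mathrm{WM}}^{\mathrm{GB}}$ (described in the context) has completeness and soundness errors at most $2\delta$ for distributional weighted Hamming-weight verification in the gray-box model. In particular, when $\delta\leq1/6$, it is an $(\varepsilon_c,\varepsilon_f)$-interactive proof with respect to $\Delta_{\mathsf{dwHW}}$. For every fixed $\delta$, using the logarithmic-round Hamming-weight protocol (see context), its resource bounds are as follows: (i) the verifier makes $\widetilde{O}(1/g)$ chosen-randomness calls to $G$ and $\widetilde{O}(1/g)$ queries to $f$; (ii) the honest prover makes $O(1/g^2)$ chosen-randomness calls to $G$ and $O(1/g^2)$ queries to $f$; (iii) the communication is $O(R)+\widetilde{O}(1/g)$ bits, and the number of rounds is $O(\log(1/g))$. Any other round-query trade-off of a tolerant Hamming-weight IPP (such as the one-round protocol with $\widetilde O(1/g^{4/3})$ verifier queries, $O(1/g^2)$ honest-prover queries and $O(\log n)+\widetilde O(1/g^{4/3})$ communication on inputs of length $n$) transfers in the same way.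
   Context: $D$ is a distribution over a finite domain $\mathcal{X}$, $f\colon\mathcal{X}\to\{0,1\}$, and $\mathrm{wt}_D(f):=\mathbb{E}_{X\sim D}[f(X)]$. For a claim $\sigma\in[0,1]$, $\Delta_{\mathsf{dwHW}}((D,f),\sigma):=|\mathrm{wt}_D(f)-\sigma|$. Gray-box model: there is a deterministic sampling oracle $G\colon\{0,1\}^R\to\mathcal{X}$ with $G(U_R)\sim D$ for $U_R$ uniform on $\{0,1\}^R$; both parties may invoke $G$ on a random tape of their choice (each invocation is one call) and may query $f$. $f$ and $G$ are fixed before the protocol begins. An $(\varepsilon_c,\varepsilon_f)$-interactive proof with respect to $\Delta_{\mathsf{dwHW}}$ consists of a verifier and a designated honest prover such that: if $\Delta_{\mathsf{dwHW}}((D,f),\sigma)\leq\varepsilon_c$ the verifier accepts the honest prover with probability at least $2/3$; if $\Delta_{\mathsf{dwHW}}((D,f),\sigma)>\varepsilon_f$ then against every (unbounded, fully informed) prover it accepts with probability at most $1/3$. Completeness (soundness) error is the bound on the rejection (acceptance) probability in the first (second) case. A tolerant Hamming-weight protocol with radii $\varepsilon_c,\varepsilon_f$ and errors at most $2\delta$: on oracle access to $z\in\{0,1\}^n$ and a claimed relative weight $\sigma$, the verifier accepts the honest prover with probability at least $1-2\delta$ if $|\mathrm{wt}(z)-\sigma|\le\varepsilon_c$, and accepts any prover with probability at most $2\delta$ if $|\mathrm{wt}(z)-\sigma|>\varepsilon_f$, where $\mathrm{wt}(z)=\frac1n\sum_i z_i$. The logarithmic-round protocol is such a protocol (sequentially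 amplified) which, for fixed $\delta$, has $O(\log(1/g))$ rounds, $\widetilde{O}(1/g)$ verifier queries, $O(1/g^2)$ honest-prover queries, and communication $O(\log n)+\widetilde{O}(1/g)$. $\widetilde O$ suppresses polylogarithmic factors. Protocol $\Pi_{\mathrm{WM}}^{\mathrm{GB}}$: define the virtual string $z\colon\{0,1\}^R\to\{0,1\}$ (of length $2^R$) by $z(r)=f(G(r))$, and run this tolerant logarithmic-round Hamming-weight protocol, amplified to completeness and soundness errors at most $2\delta$, on oracle access to $z$ with claimed weight $\sigma$ and radii $\varepsilon_c,\varepsilon_f$; whenever a party queries $z(r)$, it invokes $G(r)$ and then queries $f(G(r))$. -}

module Defs where

open import Level using (Level; 0ℓ; _⊔_) renaming (suc to lsuc)
open import Algebra.Bundles using (CommutativeRing)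
open import Data.Bool using (Bool; true; false; not; if_then_else_)
open import Data.Fin using (Fin; finToFun; _≟_)
open import Data.Fin.Properties using (2↔Bool)
open import Data.List using (List; []; _∷_; _++_; length; filterᵇ)
open import Data.Nat as ℕ using (ℕ; zero; suc; NonZero)
open import Data.Nat.Logarithm using (⌈log₂_⌉)
open import Data.Product using (∃-syntax; _×_; _,_)
open import Data.Sum using (_⊎_)
open import Data.Vec using (Vec; []; _∷_; tabulate)
open import Function using (Inverse)
open import Relation.Binary using (Rel; IsStrictPartialOrder)
open import Relation.Nullary using (¬_; does)
open import Relation.Unary using (Pred)
import Algebra.Properties.Semiring.Exp as Exp
import Algebra.Properties.Semiring.Mult as Mult
import Algebra.Properties.Semiring.Sum as Sum

-- Archimedean ordered fields, axiomatised so that both the classical and the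
-- constructive real numbers (and ℚ) are instances: `x ≤ y` is `¬ y < x`,
-- cotransitivity replaces decidability of the order, maxima are given by
-- their universal property, and inverses are given for positive elements.

record OrderedField (c ℓ₁ ℓ₂ : Level) : Set (lsuc (c ⊔ ℓ₁ ⊔ ℓ₂)) where
  infix  4 _<_ _≤_
  infixl 6 _∨_ _-_

  field
    commutativeRing : CommutativeRing c ℓ₁

  open CommutativeRing commutativeRing public hiding (_-_)
  open Mult semiring using () renaming (_×_ to _·_)
  open Exp semiring public using (_^_)
  open Sum semiring public using (sum)

  fromℕ : ℕ → Carrier
  fromℕ n = n · 1#

  _-_ : Carrier → Carrier → Carrier
  x - y = x + (- y)

  field
    _<_                  : Rel Carrier ℓ₂
    isStrictPartialOrder : IsStrictPartialOrder _≈_ _<_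

  open IsStrictPartialOrder isStrictPartialOrder public
    using (<-resp-≈; <-respˡ-≈; <-respʳ-≈)
    renaming (irrefl to <-irrefl; trans to <-trans)

  _≤_ : Rel Carrier ℓ₂
  x ≤ y = ¬ (y < x)

  field
    <-cotrans   : ∀ {x y} → x < y → ∀ z → x < z ⊎ z < y
    ≤-antisym   : ∀ {x y} → x ≤ y → y ≤ x → x ≈ y
    0<1         : 0# < 1#
    +-monoˡ-<   : ∀ {x y} z → x < y → x + z < y + z
    *-pos       : ∀ {x y} → 0# < x → 0# < y → 0# < x * y
    inv         : ∀ x → 0# < x → Carrier
    inv-inverse : ∀ x (0<x : 0# < x) → x * inv x 0<x ≈ 1#
    _∨_         : Carrier → Carrier → Carrier
    x≤x∨y       : ∀ x y → x ≤ x ∨ y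
    y≤x∨y       : ∀ x y → y ≤ x ∨ y
    ∨-least     : ∀ {x y z} → x ≤ z → y ≤ z → x ∨ y ≤ z
    archimedean : ∀ x → ∃[ n ] x < fromℕ n

  ∣_∣ : Carrier → Carrier
  ∣ x ∣ = x ∨ (- x)

  0<fromℕ : ∀ n .{{_ : NonZero n}} → 0# < fromℕ n
  0<fromℕ (suc zero)    = <-respʳ-≈ (sym (+-identityʳ 1#)) 0<1
  0<fromℕ (suc (suc n)) = <-trans (0<fromℕ (suc n))
    (<-respˡ-≈ (+-identityˡ _) (+-monoˡ-< (fromℕ (suc n)) 0<1))

  1/_ : ∀ n .{{_ : NonZero n}} → Carrier
  1/ n = inv (fromℕ n) (0<fromℕ n)

  x<y⇒0<y-x : ∀ {x y} → x < y → 0# < y - x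
  x<y⇒0<y-x {x} x<y = <-respˡ-≈ (-‿inverseʳ x) (+-monoˡ-< (- x) x<y)

record Interface : Set₁ where
  field
    Query  : Set
    Answer : Query → Set

open Interface

Oracle : Interface → Set
Oracle I = (q : Query I) → Answer I q

data Comp (I : Interface) (A : Set) : Set where
  return : A → Comp I A
  query  : (q : Query I) → (Answer I q → Comp I A) → Comp I A

-- One `exchange` is one round: the verifier sends `msg` and reads a reply of
-- the prescribed length ℓ.

data VerifierTree (I : Interface) : Set where
  decide   : Bool → VerifierTree I
  query    : (q : Query I) → (Answer I q → VerifierTree I) → VerifierTree I
  exchange : (msg : List Bool) (ℓ : ℕ) → (Vec Bool ℓ → VerifierTree I) →
             VerifierTree I

record Verifier (I : Interface) : Set where
  field
    coins : ℕ
    tree  : Vec Bool coins → VerifierTree I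

-- Nothing bounds a prover's queries or its computation, and a prover
-- quantified after the oracle may depend on the oracle in any way.

record Prover (I : Interface) : Set₁ where
  field
    State   : Set
    coins   : ℕ
    start   : Vec Bool coins → State
    respond : State → List Bool → (ℓ : ℕ) → Comp I (State × Vec Bool ℓ)

record Protocol (I : Interface) : Set₁ where
  field
    verifier : Verifier I
    honest   : Prover I

record Execution (I : Interface) : Set where
  field
    accepted      : Bool
    verifierLog   : List (Query I)
    proverLog     : List (Query I)
    rounds        : ℕ
    communication : ℕ

module _ {I : Interface} (o : Oracle I) where

  runComp : {A : Set} → Comp I A → List (Query I) × A
  runComp (return a)  = [] , a
  runComp (query q k) = let log , a = runComp (k (o q)) in q ∷ log , a

  module _ (P : Prover I) where
    open Prover P

    runTree : State → VerifierTree I → Execution I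
    runTree s (decide b) = record
      { accepted = b ; verifierLog = [] ; proverLog = []
      ; rounds = 0 ; communication = 0 }
    runTree s (query q k) =
      let e = runTree s (k (o q)) in
      record e { verifierLog = q ∷ Execution.verifierLog e }
    runTree s (exchange msg ℓ k) =
      let log , s′ , reply = runComp (respond s msg ℓ)
          e                = runTree s′ (k reply)
      in record e
        { proverLog     = log ++ Execution.proverLog e
        ; rounds        = suc (Execution.rounds e)
        ; communication = length msg ℕ.+ ℓ ℕ.+ Execution.communication e }

  run : (V : Verifier I) (P : Prover I) →
        Vec Bool (Verifier.coins V) → Vec Bool (Prover.coins P) → Execution I
  run V P ρ ρ′ = runTree P (Prover.start P ρ′) (Verifier.tree V ρ)

bitString : ℕ → Interface
bitString n = record { Query = Fin n ; Answer = λ _ → Bool }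

data GrayBoxQuery (R N : ℕ) : Set where
  sample   : Vec Bool R → GrayBoxQuery R N
  evaluate : Fin N → GrayBoxQuery R N

GrayBoxAnswer : ∀ {R N} → GrayBoxQuery R N → Set
GrayBoxAnswer {N = N} (sample _)   = Fin N
GrayBoxAnswer         (evaluate _) = Bool

grayBox : (R N : ℕ) → Interface
grayBox R N = record { Query = GrayBoxQuery R N ; Answer = GrayBoxAnswer }

grayBoxOracle : ∀ {R N} → (Vec Bool R → Fin N) → (Fin N → Bool) →
                Oracle (grayBox R N)
grayBoxOracle G f (sample r)   = G r
grayBoxOracle G f (evaluate x) = f x

isSample isEvaluate : ∀ {R N} → GrayBoxQuery R N → Bool
isSample (sample _)   = true
isSample (evaluate _) = false
isEvaluate q = not (isSample q)

#samples #evaluations : ∀ {R N} → List (GrayBoxQuery R N) → ℕ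
#samples     log = length (filterᵇ isSample log)
#evaluations log = length (filterᵇ isEvaluate log)

-- The binary-expansion bijection between positions of a string of length 2^R
-- and random tapes.

tape : ∀ {R} → Fin (2 ℕ.^ R) → Vec Bool R
tape i = tabulate (λ j → Inverse.to 2↔Bool (finToFun i j))

-- The protocol run on the virtual string z(r) = f(G(r)). It is obtained from
-- the string protocol alone: G and f are reached only through the oracles.

module _ {R N : ℕ} where

  virtualComp : {A : Set} → Comp (bitString (2 ℕ.^ R)) A → Comp (grayBox R N) A
  virtualComp (return a)  = return a
  virtualComp (query i k) =
    query (sample (tape i)) λ x → query (evaluate x) λ b → virtualComp (k b)

  virtualTree : VerifierTree (bitString (2 ℕ.^ R)) → VerifierTree (grayBox R N)
  virtualTree (decide b)         = decide b
  virtualTree (query i k)        =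
    query (sample (tape i)) λ x → query (evaluate x) λ b → virtualTree (k b)
  virtualTree (exchange msg ℓ k) = exchange msg ℓ λ a → virtualTree (k a)

  virtualProtocol : Protocol (bitString (2 ℕ.^ R)) → Protocol (grayBox R N)
  virtualProtocol Π = record
    { verifier = record
      { coins = Verifier.coins verifier
      ; tree  = λ ρ → virtualTree (Verifier.tree verifier ρ) }
    ; honest = record
      { State   = Prover.State honest
      ; coins   = Prover.coins honest
      ; start   = Prover.start honest
      ; respond = λ s msg ℓ → virtualComp (Prover.respond honest s msg ℓ) } }
    where open Protocol Π

-- A bound is given as a predicate on the measured number, so that it may be
-- of any form. Verifier queries, rounds and communication are measured
-- against every prover, and the honest prover's queries in its interaction
-- with the verifier.

record Bounds (p : Level) : Set (lsuc p) where
  field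
    verifierQueries proverQueries rounds communication : Pred ℕ p

module _ {p : Level} (B : Bounds p) where

  module _ {I : Interface} (Π : Protocol I) (o : Oracle I) where
    open Protocol Π

    ForAllProvers : (Execution I → Set p) → Set (lsuc 0ℓ ⊔ p)
    ForAllProvers Q = ∀ P ρ ρ′ → Q (run o verifier P ρ ρ′)

    ForHonestProver : (Execution I → Set p) → Set p
    ForHonestProver Q = ∀ ρ ρ′ → Q (run o verifier honest ρ ρ′)

  open Execution

  record StringWithin {n} (Π : Protocol (bitString n)) :
                      Set (lsuc 0ℓ ⊔ p) where
    field
      verifierQueries : ∀ z → ForAllProvers Π z λ e →
        Bounds.verifierQueries B (length (verifierLog e))
      proverQueries   : ∀ z → ForHonestProver Π z λ e →
        Bounds.proverQueries B (length (proverLog e))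
      roundCount      : ∀ z → ForAllProvers Π z λ e →
        Bounds.rounds B (rounds e)
      bits            : ∀ z → ForAllProvers Π z λ e →
        Bounds.communication B (communication e)

  record GrayBoxWithin {R N} (Π : Protocol (grayBox R N)) :
                       Set (lsuc 0ℓ ⊔ p) where
    field
      verifierSamples     : ∀ G f → ForAllProvers Π (grayBoxOracle G f) λ e →
        Bounds.verifierQueries B (#samples (verifierLog e))
      verifierEvaluations : ∀ G f → ForAllProvers Π (grayBoxOracle G f) λ e →
        Bounds.verifierQueries B (#evaluations (verifierLog e))
      proverSamples       : ∀ G f → ForHonestProver Π (grayBoxOracle G f) λ e →
        Bounds.proverQueries B (#samples (proverLog e))
      proverEvaluations   : ∀ G f → ForHonestProver Π (grayBoxOracle G f) λ e →
        Bounds.proverQueries B (#evaluations (proverLog e))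
      roundCount          : ∀ G f → ForAllProvers Π (grayBoxOracle G f) λ e →
        Bounds.rounds B (rounds e)
      bits                : ∀ G f → ForAllProvers Π (grayBoxOracle G f) λ e →
        Bounds.communication B (communication e)

module WeightVerification {c ℓ₁ ℓ₂} (𝔽 : OrderedField c ℓ₁ ℓ₂) where
  open OrderedField 𝔽

  indicator : Bool → Carrier
  indicator b = if b then 1# else 0#

  𝔼 : ∀ n → (Vec Bool n → Carrier) → Carrier
  𝔼 zero    h = h []
  𝔼 (suc n) h = 1/ 2 * (𝔼 n (λ r → h (false ∷ r)) + 𝔼 n (λ r → h (true ∷ r)))

  ℙ : ∀ n → (Vec Bool n → Bool) → Carrier
  ℙ n A = 𝔼 n (λ r → indicator (A r))

  record Radii : Set (c ⊔ ℓ₂) where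
    field
      εc εf : Carrier
      0≤εc  : 0# ≤ εc
      εc<εf : εc < εf
      εf≤1  : εf ≤ 1#

    gap gap⁻¹ : Carrier
    gap   = εf - εc
    gap⁻¹ = inv gap (x<y⇒0<y-x εc<εf)

  record ErrorParameter : Set (c ⊔ ℓ₂) where
    field
      δ     : Carrier
      0<δ   : 0# < δ
      δ<1/4 : δ < 1/ 4

    2δ : Carrier
    2δ = fromℕ 2 * δ

  record Claim : Set (c ⊔ ℓ₂) where
    field
      σ   : Carrier
      0≤σ : 0# ≤ σ
      σ≤1 : σ ≤ 1#

  -- Verification problems: instances with oracle access, together with the
  -- distance of an instance from a claim.
  record Problem (I : Interface) : Set (lsuc (c ⊔ ℓ₁ ⊔ ℓ₂)) where
    field
      Instance : Set (c ⊔ ℓ₁ ⊔ ℓ₂)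
      oracle   : Instance → Oracle I
      Δ        : Instance → Claim → Carrier

  module _ {I : Interface} (o : Oracle I) (V : Verifier I) (P : Prover I) where

    Pr[_] : (Bool → Bool) → Carrier
    Pr[ event ] = 𝔼 (Verifier.coins V) λ ρ → ℙ (Prover.coins P) λ ρ′ →
      event (Execution.accepted (run o V P ρ ρ′))

    Pr[accept] Pr[reject] : Carrier
    Pr[accept] = Pr[ (λ b → b) ]
    Pr[reject] = Pr[ not ]

  module _ {I : Interface} (𝒫 : Problem I) (ε : Radii)
           (Π : Claim → Protocol I) where
    open Problem 𝒫
    open Radii ε
    private
      V : Claim → Verifier I
      V σ = Protocol.verifier (Π σ)

      H : Claim → Prover I
      H σ = Protocol.honest (Π σ)

    AcceptsCloseWithProb≥ : Carrier → Set (c ⊔ ℓ₁ ⊔ ℓ₂)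
    AcceptsCloseWithProb≥ a = ∀ i σ → Δ i σ ≤ εc →
      a ≤ Pr[accept] (oracle i) (V σ) (H σ)

    CompletenessError≤ : Carrier → Set (c ⊔ ℓ₁ ⊔ ℓ₂)
    CompletenessError≤ e = ∀ i σ → Δ i σ ≤ εc →
      Pr[reject] (oracle i) (V σ) (H σ) ≤ e

    SoundnessError≤ : Carrier → Set (lsuc 0ℓ ⊔ c ⊔ ℓ₁ ⊔ ℓ₂)
    SoundnessError≤ e = ∀ i σ → εf < Δ i σ → ∀ (P : Prover I) →
      Pr[accept] (oracle i) (V σ) P ≤ e

    IsInteractiveProof : Set (lsuc 0ℓ ⊔ c ⊔ ℓ₁ ⊔ ℓ₂)
    IsInteractiveProof =
      AcceptsCloseWithProb≥ (fromℕ 2 * 1/ 3) × SoundnessError≤ (1/ 3)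

    IsTolerant : ErrorParameter → Set (lsuc 0ℓ ⊔ c ⊔ ℓ₁ ⊔ ℓ₂)
    IsTolerant d = AcceptsCloseWithProb≥ (1# - 2δ) × SoundnessError≤ 2δ
      where open ErrorParameter d

  wt : ∀ n .{{_ : NonZero n}} → (Fin n → Bool) → Carrier
  wt n z = 1/ n * sum (λ i → indicator (z i))

  HW : ∀ n .{{_ : NonZero n}} → Problem (bitString n)
  HW n = record
    { Instance = Level.Lift (c ⊔ ℓ₁ ⊔ ℓ₂) (Fin n → Bool)
    ; oracle   = Level.lower
    ; Δ        = λ z σ → ∣ wt n (Level.lower z) - Claim.σ σ ∣ }

  record Distribution (N : ℕ) : Set (c ⊔ ℓ₁ ⊔ ℓ₂) where
    field
      mass        : Fin N → Carrier
      nonNegative : ∀ x → 0# ≤ mass x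
      total       : sum mass ≈ 1#

  open Distribution

  wtᴰ : ∀ {N} → Distribution N → (Fin N → Bool) → Carrier
  wtᴰ D f = sum (λ x → mass D x * indicator (f x))

  record GrayBoxInstance (R N : ℕ) : Set (c ⊔ ℓ₁ ⊔ ℓ₂) where
    field
      D       : Distribution N
      f       : Fin N → Bool
      G       : Vec Bool R → Fin N
      samples : ∀ x → ℙ R (λ r → does (G r ≟ x)) ≈ mass D x

  dwHW : ∀ R N → Problem (grayBox R N)
  dwHW R N = record
    { Instance = GrayBoxInstance R N
    ; oracle   = λ i → grayBoxOracle (G i) (f i)
    ; Δ        = λ i σ → ∣ wtᴰ (D i) (f i) - Claim.σ σ ∣ }
    where open GrayBoxInstance

  StringFamily : Set (lsuc 0ℓ ⊔ c ⊔ ℓ₂)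
  StringFamily = (n : ℕ) → Radii → ErrorParameter → Claim →
                 Protocol (bitString n)

  IsTolerantFamily : StringFamily → Set (lsuc 0ℓ ⊔ c ⊔ ℓ₁ ⊔ ℓ₂)
  IsTolerantFamily Π =
    ∀ n .{{_ : NonZero n}} ε d → IsTolerant (HW n) ε (Π n ε d) d

  ΠGBWM : StringFamily → ∀ R N → Radii → ErrorParameter → Claim →
          Protocol (grayBox R N)
  ΠGBWM Π R N ε d σ = virtualProtocol (Π (2 ℕ.^ R) ε d σ)

  -- For m = ⌈1/g⌉ this is log₂(1/g) up to constants, the summand 1 keeping it
  -- positive at g = 1. The bounds below quantify over all m ≥ 1/g, the least of
  -- which is ⌈1/g⌉.
  L : ℕ → ℕ
  L m = 1 ℕ.+ ⌈log₂ m ⌉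

  module _ (C k : ℕ) (ε : Radii) where
    open Radii ε

    O[log[1/g]] : Pred ℕ ℓ₂
    O[log[1/g]] r = ∀ m → gap⁻¹ ≤ fromℕ m → fromℕ r ≤ fromℕ (C ℕ.* L m)

    O[1/g²] : Pred ℕ ℓ₂
    O[1/g²] q = fromℕ q ≤ fromℕ C * gap⁻¹ ^ 2

    -- q = Õ((1/g)^(a/b)), with both sides raised to the power b.
    Õ[1/g^_/_] : ℕ → ℕ → Pred ℕ ℓ₂
    Õ[1/g^ a / b ] q = ∀ m → gap⁻¹ ≤ fromℕ m →
      fromℕ (q ℕ.^ b) ≤ fromℕ C * gap⁻¹ ^ a * fromℕ (L m ℕ.^ k)

    -- Here s is log n for strings of length n, and R in the gray-box model.
    O[_]+Õ[1/g^_/_] : ℕ → ℕ → ℕ → Pred ℕ ℓ₂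
    O[ s ]+Õ[1/g^ a / b ] q =
      ∃[ t ] (q ℕ.≤ C ℕ.* s ℕ.+ t × Õ[1/g^ a / b ] t)

    logRoundBounds : ℕ → Bounds ℓ₂
    logRoundBounds s = record
      { verifierQueries = Õ[1/g^ 1 / 1 ]
      ; proverQueries   = O[1/g²]
      ; rounds          = O[log[1/g]]
      ; communication   = O[ s ]+Õ[1/g^ 1 / 1 ] }

    oneRoundBounds : ℕ → Bounds ℓ₂
    oneRoundBounds s = record
      { verifierQueries = Õ[1/g^ 4 / 3 ]
      ; proverQueries   = O[1/g²]
      ; rounds          = λ r → Level.Lift ℓ₂ (r ℕ.≤ 1)
      ; communication   = O[ s ]+Õ[1/g^ 4 / 3 ] }

  -- The constants C and k may depend on δ only.

  module _ (bounds : (C k : ℕ) → Radii → ℕ → Bounds ℓ₂) (Π : StringFamily)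
           (d : ErrorParameter) where

    StringBounded : Set (lsuc 0ℓ ⊔ c ⊔ ℓ₂)
    StringBounded = ∃[ C ] ∃[ k ] (∀ n .{{_ : NonZero n}} ε σ →
      StringWithin (bounds C k ε ⌈log₂ n ⌉) (Π n ε d σ))

    GrayBoxBounded : Set (lsuc 0ℓ ⊔ c ⊔ ℓ₂)
    GrayBoxBounded = ∃[ C ] ∃[ k ] (∀ R N ε σ →
      GrayBoxWithin (bounds C k ε R) (ΠGBWM Π R N ε d σ))

{-# OPTIONS --safe #-}

-- Against the virtual string, a gray-box prover is a string prover that knows
-- G and f and asks no queries, and the two executions agree step by step; the
-- only change is that each string query becomes one call to G and one to f.
-- Averaging over tapes, the weight of the virtual string is E[f(G(U_R))], which
-- is the D-weight of f, so that the distances to the claim coincide as well.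

module Submission where

open import Algebra.Bundles using (CommutativeMonoid)
open import Defs
open import Data.Bool using (Bool; true; false; not)
open import Data.Fin as Fin using (Fin; zero; suc; combine; _↑ˡ_; _↑ʳ_)
open import Data.Fin.Properties using (2↔Bool; remQuot-combine)
open import Data.List using (List; []; _∷_; _++_; length; concatMap)
open import Data.List.Properties using (concatMap-++)
open import Data.Nat as ℕ using (ℕ; zero; suc; NonZero)
open import Data.Nat.Logarithm using (⌈log₂_⌉; ⌈log₂2^n⌉≡n)
open import Data.Nat.Properties using (m^n≢0)
open import Data.Product using (_×_; _,_; proj₂; map₁)
open import Data.Sum using ([_,_]′)
open import Data.Vec using (Vec; []; _∷_)
open import Function using (Inverse; _∘_)
open import Level using (Level; lift)
open import Relation.Binary.PropositionalEquality as ≡ using (_≡_; cong; subst)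
open import Relation.Nullary using (does)
import Algebra.Properties.CommutativeSemigroup as CommutativeSemigroupProperties
import Algebra.Properties.Semiring.Mult as Mult
import Algebra.Properties.Semiring.Sum as Sum
import Relation.Binary.Reasoning.Setoid as SetoidReasoning

-- Tapes, the virtual string and the step-by-step simulation of executions

-- `finToFun` reads its leading digit as the quotient by `2 ^ R`, which `combine` puts there.
-- Splitting positions into two halves thus matches the recursion of `𝔼` on the first bit.
tape-combine : ∀ {R} (b : Fin 2) (j : Fin (2 ℕ.^ R)) →
  tape {suc R} (combine b j) ≡ Inverse.to 2↔Bool b ∷ tape j
tape-combine {R} b j = cong
  (λ (q , r) → Inverse.to 2↔Bool q ∷ tape {R} r) (remQuot-combine b j)

module _ {R N : ℕ} (G : Vec Bool R → Fin N) (f : Fin N → Bool) where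

  virtualString : Fin (2 ℕ.^ R) → Bool
  virtualString i = f (G (tape i))

  virtualLog : List (Fin (2 ℕ.^ R)) → List (GrayBoxQuery R N)
  virtualLog = concatMap (λ i → sample (tape i) ∷ evaluate (G (tape i)) ∷ [])

  #samples-virtualLog : ∀ log → #samples (virtualLog log) ≡ length log
  #samples-virtualLog []        = ≡.refl
  #samples-virtualLog (_ ∷ log) = cong suc (#samples-virtualLog log)

  #evaluations-virtualLog : ∀ log → #evaluations (virtualLog log) ≡ length log
  #evaluations-virtualLog []        = ≡.refl
  #evaluations-virtualLog (_ ∷ log) = cong suc (#evaluations-virtualLog log)

  virtualExecution : Execution (bitString (2 ℕ.^ R)) → Execution (grayBox R N)
  virtualExecution e = record
    { accepted      = accepted e
    ; verifierLog   = virtualLog (verifierLog e)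
    ; proverLog     = virtualLog (proverLog e)
    ; rounds        = rounds e
    ; communication = communication e }
    where open Execution

  -- The oracle calls of `P` are answered internally, `G` and `f` being fixed in advance. This turns
  -- a guarantee against all string provers into one against all gray-box provers.
  informedProver : Prover (grayBox R N) → Prover (bitString (2 ℕ.^ R))
  informedProver P = record
    { State   = State
    ; coins   = coins
    ; start   = start
    ; respond = λ s msg ℓ →
        return (proj₂ (runComp (grayBoxOracle G f) (respond s msg ℓ))) }
    where open Prover P

  -- The informed prover logs nothing, whereas `P` may make any calls, so the two prover logs cannot
  -- be compared. Overwriting that field with its own value on the left leaves a claim about the
  -- other four fields only.
  runTree-informed : ∀ P s t →
    let e  = runTree (grayBoxOracle G f) P s (virtualTree t)
        e′ = runTree virtualString (informedProver P) s t
    in e ≡ record (virtualExecution e′) { proverLog = Execution.proverLog e }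
  runTree-informed P s (decide b)         = ≡.refl
  runTree-informed P s (query i k)        = cong
    (λ e → record e { verifierLog =
      sample (tape i) ∷ evaluate (G (tape i)) ∷ Execution.verifierLog e })
    (runTree-informed P s (k (virtualString i)))
  runTree-informed P s (exchange msg ℓ k) =
    let log , s′ , reply =
          runComp (grayBoxOracle G f) (Prover.respond P s msg ℓ)
    in cong
      (λ e → record e
        { proverLog     = log ++ Execution.proverLog e
        ; rounds        = suc (Execution.rounds e)
        ; communication = length msg ℕ.+ ℓ ℕ.+ Execution.communication e })
      (runTree-informed P s′ (k reply))

  runComp-virtual : ∀ {A} (m : Comp (bitString (2 ℕ.^ R)) A) →
    runComp (grayBoxOracle G f) (virtualComp m) ≡
    map₁ virtualLog (runComp virtualString m)
  runComp-virtual (return a)  = ≡.refl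
  runComp-virtual (query i k) =
    cong (map₁ (λ log → sample (tape i) ∷ evaluate (G (tape i)) ∷ log))
      (runComp-virtual (k (virtualString i)))

  module _ (Π : Protocol (bitString (2 ℕ.^ R))) where
    open Protocol Π

    -- Here the prover log is compared too, as the bounds on the honest prover require. In an
    -- exchange, the reply is rewritten by `runComp-virtual`, the rest of the run by induction, and
    -- the two logs are then joined.
    runTree-honest : ∀ s t →
      runTree (grayBoxOracle G f) (Protocol.honest (virtualProtocol Π))
        s (virtualTree t) ≡
      virtualExecution (runTree virtualString honest s t)
    runTree-honest s (decide b)  = ≡.refl
    runTree-honest s (query i k) = cong
      (λ e → record e { verifierLog =
        sample (tape i) ∷ evaluate (G (tape i)) ∷ Execution.verifierLog e })
      (runTree-honest s (k (virtualString i)))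
    runTree-honest s (exchange msg ℓ k) =
      let log , s′ , reply =
            runComp virtualString (Prover.respond honest s msg ℓ)
          e = runTree virtualString honest s′ (k reply)
      in ≡.trans
        (cong
          (λ (log′ , s″ , reply′) → round log′
            (runTree (grayBoxOracle G f) (Protocol.honest (virtualProtocol Π))
              s″ (virtualTree (k reply′))))
          (runComp-virtual (Prover.respond honest s msg ℓ)))
        (≡.trans (cong (round (virtualLog log)) (runTree-honest s′ (k reply)))
          (cong
            -- The `[]` is a placeholder: the prover log is overwritten at once, and only the other
            -- fields of `round` are kept.
            (λ log′ → record (round [] (virtualExecution e)) { proverLog = log′ })
            (≡.sym (concatMap-++ _ log (Execution.proverLog e)))))
      where
        round : List (GrayBoxQuery R N) → Execution (grayBox R N) →
                Execution (grayBox R N)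
        round log e = record e
          { proverLog     = log ++ Execution.proverLog e
          ; rounds        = suc (Execution.rounds e)
          ; communication = length msg ℕ.+ ℓ ℕ.+ Execution.communication e }

-- Transfer of resource bounds

-- Each measured number equals its counterpart in a string execution, with calls to `G` and calls to
-- `f` each as numerous as the string queries. Since the numbers are equal, `subst` carries over a
-- bound of any form.
virtualProtocol-within : ∀ {p R N} (B : Bounds p)
  (Π : Protocol (bitString (2 ℕ.^ R))) →
  StringWithin B Π → GrayBoxWithin B (virtualProtocol {R} {N} Π)
virtualProtocol-within {p} {R} {N} B Π within = record
  { verifierSamples     = λ G f P ρ ρ′ → subst B.verifierQueries
      (≡.sym (≡.trans (cong (#samples ∘ verifierLog) (informed G f P ρ ρ′))
        (#samples-virtualLog G f (verifierLog (execᴾ G f P ρ ρ′)))))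
      (verifierQueries (virtualString G f) (informedProver G f P) ρ ρ′)
  ; verifierEvaluations = λ G f P ρ ρ′ → subst B.verifierQueries
      (≡.sym (≡.trans (cong (#evaluations ∘ verifierLog) (informed G f P ρ ρ′))
        (#evaluations-virtualLog G f (verifierLog (execᴾ G f P ρ ρ′)))))
      (verifierQueries (virtualString G f) (informedProver G f P) ρ ρ′)
  ; proverSamples       = λ G f ρ ρ′ → subst B.proverQueries
      (≡.sym (≡.trans (cong (#samples ∘ proverLog) (honestly G f ρ ρ′))
        (#samples-virtualLog G f (proverLog (execᴴ G f ρ ρ′)))))
      (proverQueries (virtualString G f) ρ ρ′)
  ; proverEvaluations   = λ G f ρ ρ′ → subst B.proverQueries
      (≡.sym (≡.trans (cong (#evaluations ∘ proverLog) (honestly G f ρ ρ′))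
        (#evaluations-virtualLog G f (proverLog (execᴴ G f ρ ρ′)))))
      (proverQueries (virtualString G f) ρ ρ′)
  ; roundCount          = λ G f P ρ ρ′ → subst B.rounds
      (≡.sym (cong rounds (informed G f P ρ ρ′)))
      (roundCount (virtualString G f) (informedProver G f P) ρ ρ′)
  ; bits                = λ G f P ρ ρ′ → subst B.communication
      (≡.sym (cong communication (informed G f P ρ ρ′)))
      (bits (virtualString G f) (informedProver G f P) ρ ρ′)
  }
  where
    open Protocol Π
    open Execution
    open StringWithin within
    module B = Bounds B

    execᴾ = λ G f P ρ ρ′ →
      run (virtualString {R} {N} G f) verifier (informedProver G f P) ρ ρ′
    execᴴ = λ G f ρ ρ′ → run (virtualString {R} {N} G f) verifier honest ρ ρ′

    informed = λ G f P ρ ρ′ → runTree-informed {R} {N} G f P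
      (Prover.start P ρ′) (Verifier.tree verifier ρ)
    honestly = λ G f ρ ρ′ → runTree-honest {R} {N} G f Π
      (Prover.start honest ρ′) (Verifier.tree verifier ρ)

-- Arithmetic in ordered fields

module OrderedFieldProperties {c ℓ₁ ℓ₂} (𝔽 : OrderedField c ℓ₁ ℓ₂) where
  open OrderedField 𝔽
  open SetoidReasoning setoid

  ≤-reflexive : ∀ {x y} → x ≈ y → x ≤ y
  ≤-reflexive x≈y y<x = <-irrefl (sym x≈y) y<x

  -- Cotransitivity compares a supposed `z < x` with `y`, and each of the two outcomes is refuted by
  -- a hypothesis.
  ≤-trans : ∀ {x y z} → x ≤ y → y ≤ z → x ≤ z
  ≤-trans {y = y} x≤y y≤z z<x = [ y≤z , x≤y ]′ (<-cotrans z<x y)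

  [x+y]-y≈x : ∀ x y → (x + y) - y ≈ x
  [x+y]-y≈x x y = begin
    (x + y) - y   ≈⟨ +-assoc x y (- y) ⟩
    x + (y - y)   ≈⟨ +-congˡ (-‿inverseʳ y) ⟩
    x + 0#        ≈⟨ +-identityʳ x ⟩
    x             ∎

  +-monoˡ-≤ : ∀ {x y} z → x ≤ y → x + z ≤ y + z
  +-monoˡ-≤ {x} {y} z x≤y y+z<x+z = x≤y
    (<-respˡ-≈ ([x+y]-y≈x y z) (<-respʳ-≈ ([x+y]-y≈x x z)
      (+-monoˡ-< (- z) y+z<x+z)))

  +-mono-≤ : ∀ {x y u v} → x ≤ y → u ≤ v → x + u ≤ y + v
  +-mono-≤ {x} {y} {u} {v} x≤y u≤v = ≤-trans (+-monoˡ-≤ u x≤y)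
    (≤-trans (≤-reflexive (+-comm y u))
      (≤-trans (+-monoˡ-≤ y u≤v) (≤-reflexive (+-comm v y))))

  x+y≤z⇒x≤z-y : ∀ {x y z} → x + y ≤ z → x ≤ z - y
  x+y≤z⇒x≤z-y {x} {y} x+y≤z =
    ≤-trans (≤-reflexive (sym ([x+y]-y≈x x y))) (+-monoˡ-≤ (- y) x+y≤z)

  x-y≤z⇒x-z≤y : ∀ {x y z} → x - y ≤ z → x - z ≤ y
  x-y≤z⇒x-z≤y {x} {y} {z} x-y≤z z<x-z = x-y≤z
    (<-respˡ-≈ ([x+y]-y≈x z y) (+-monoˡ-< (- y) z+y<x))
    where
      z+y<x : z + y < x
      z+y<x = <-respˡ-≈ (+-comm y z) (<-respʳ-≈ (begin
        (x - z) + z       ≈⟨ +-assoc x (- z) z ⟩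
        x + (- z + z)     ≈⟨ +-congˡ (-‿inverseˡ z) ⟩
        x + 0#            ≈⟨ +-identityʳ x ⟩
        x                 ∎) (+-monoˡ-< z z<x-z))

  -- Maxima are specified by their universal property alone, so congruence is derived: this
  -- inequality in both directions, then antisymmetry.
  ∨-cong-≤ : ∀ {x y u v} → x ≈ y → u ≈ v → x ∨ u ≤ y ∨ v
  ∨-cong-≤ {y = y} {v = v} x≈y u≈v = ∨-least
    (≤-trans (≤-reflexive x≈y) (x≤x∨y y v))
    (≤-trans (≤-reflexive u≈v) (y≤x∨y y v))

  ∣∣-cong : ∀ {x y} → x ≈ y → ∣ x ∣ ≈ ∣ y ∣
  ∣∣-cong x≈y = ≤-antisym (∨-cong-≤ x≈y (-‿cong x≈y))
    (∨-cong-≤ (sym x≈y) (-‿cong (sym x≈y)))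

  -- Reciprocal identities such as `1/1` and `1/-homo-*` reduce through this to multiplying out a
  -- product.
  inv-unique : ∀ {x y} (0<x : 0# < x) → x * y ≈ 1# → y ≈ inv x 0<x
  inv-unique {x} {y} 0<x xy≈1 = begin
    y                     ≈⟨ *-identityʳ y ⟨
    y * 1#                ≈⟨ *-congˡ (inv-inverse x 0<x) ⟨
    y * (x * inv x 0<x)   ≈⟨ *-assoc y x _ ⟨
    y * x * inv x 0<x     ≈⟨ *-congʳ (trans (*-comm y x) xy≈1) ⟩
    1# * inv x 0<x        ≈⟨ *-identityˡ _ ⟩
    inv x 0<x             ∎

  n*1/n : ∀ n .{{_ : NonZero n}} → fromℕ n * 1/ n ≈ 1#
  n*1/n n = inv-inverse (fromℕ n) (0<fromℕ n)

  1/1 : 1/ 1 ≈ 1#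
  1/1 = sym (inv-unique (0<fromℕ 1) (trans (*-identityʳ _) (+-identityʳ 1#)))

  1/-homo-* : ∀ m n .{{_ : NonZero m}} .{{_ : NonZero n}}
    .{{_ : NonZero (m ℕ.* n)}} → 1/ (m ℕ.* n) ≈ 1/ m * 1/ n
  1/-homo-* m n = sym (inv-unique (0<fromℕ (m ℕ.* n)) (begin
    fromℕ (m ℕ.* n) * (1/ m * 1/ n)     ≈⟨ *-congʳ (×1-homo-* m n) ⟩
    fromℕ m * fromℕ n * (1/ m * 1/ n)   ≈⟨ *-interchange _ _ _ _ ⟩
    fromℕ m * 1/ m * (fromℕ n * 1/ n)   ≈⟨ *-cong (n*1/n m) (n*1/n n) ⟩
    1# * 1#                             ≈⟨ *-identityˡ 1# ⟩
    1#                                  ∎))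
    where
      open Mult semiring using (×1-homo-*)
      open CommutativeSemigroupProperties *-commutativeSemigroup
        using () renaming (interchange to *-interchange)

  [1+n]*x : ∀ n x → fromℕ (suc n) * x ≈ x + fromℕ n * x
  [1+n]*x n x = trans (distribʳ x 1# (fromℕ n)) (+-congʳ (*-identityˡ x))

  2*x : ∀ x → fromℕ 2 * x ≈ x + x
  2*x x = trans ([1+n]*x 1 x)
    (+-congˡ (trans (*-congʳ (+-identityʳ 1#)) (*-identityˡ x)))

  1/2*[x+x] : ∀ x → 1/ 2 * (x + x) ≈ x
  1/2*[x+x] x = begin
    1/ 2 * (x + x)         ≈⟨ *-congˡ (2*x x) ⟨
    1/ 2 * (fromℕ 2 * x)   ≈⟨ *-assoc _ _ x ⟨
    1/ 2 * fromℕ 2 * x     ≈⟨ *-congʳ (trans (*-comm _ _) (n*1/n 2)) ⟩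
    1# * x                 ≈⟨ *-identityˡ x ⟩
    x                      ∎

  -- The threshold 1/6 is half of 1/3, obtained from the factorisation 6 = 2 · 3. It brings an error
  -- of 2δ down to the 1/3 of an interactive proof.
  x≤1/6⇒2x≤1/3 : ∀ {x} → x ≤ 1/ 6 → fromℕ 2 * x ≤ 1/ 3
  x≤1/6⇒2x≤1/3 {x} x≤1/6 = ≤-trans (≤-reflexive (2*x x))
    (≤-trans (+-mono-≤ x≤1/6 x≤1/6) (≤-reflexive (begin
      1/ 6 + 1/ 6                   ≈⟨ +-cong (1/-homo-* 2 3) (1/-homo-* 2 3) ⟩
      1/ 2 * 1/ 3 + 1/ 2 * 1/ 3     ≈⟨ distribˡ _ _ _ ⟨
      1/ 2 * (1/ 3 + 1/ 3)          ≈⟨ 1/2*[x+x] _ ⟩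
      1/ 3                          ∎)))

  -- Moving `y` to the left, this is 2/3 + 1/3 = 1. It converts completeness error at most 1/3 into
  -- acceptance probability at least 2/3.
  y≤1/3⇒2/3≤1-y : ∀ {y} → y ≤ 1/ 3 → fromℕ 2 * 1/ 3 ≤ 1# - y
  y≤1/3⇒2/3≤1-y y≤1/3 = x+y≤z⇒x≤z-y
    (≤-trans (+-mono-≤ (≤-reflexive refl) y≤1/3)
      (≤-reflexive (trans (+-comm _ _)
        (trans (sym ([1+n]*x 2 (1/ 3))) (n*1/n 3)))))

-- Finite sums and expectations over tapes

module SumProperties {c ℓ₁ ℓ₂} (𝔽 : OrderedField c ℓ₁ ℓ₂) where
  open OrderedField 𝔽 hiding (zero)
  open WeightVerification 𝔽
  open OrderedFieldProperties 𝔽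
  open SetoidReasoning setoid
  open Sum semiring using (sum-cong-≋; sum-replicate-zero)
  open CommutativeSemigroupProperties
    (CommutativeMonoid.commutativeSemigroup +-commutativeMonoid)
    using () renaming (interchange to +-interchange)

  sum-↑ : ∀ m n (t : Fin (m ℕ.+ n) → Carrier) →
    sum t ≈ sum (λ i → t (i ↑ˡ n)) + sum (λ j → t (m ↑ʳ j))
  sum-↑ zero    n t = sym (+-identityˡ _)
  sum-↑ (suc m) n t =
    trans (+-congˡ (sum-↑ m n (t ∘ suc))) (sym (+-assoc _ _ _))

  -- `combine` numbers the pairs in consecutive blocks of length `n`, so the sum is split off block
  -- by block.
  sum-combine : ∀ m n (t : Fin (m ℕ.* n) → Carrier) →
    sum t ≈ sum (λ i → sum (λ j → t (combine {m} {n} i j)))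
  sum-combine zero    n t = refl
  sum-combine (suc m) n t =
    trans (sum-↑ n (m ℕ.* n) t) (+-congˡ (sum-combine m n (t ∘ (n ↑ʳ_))))

  -- The indicator is a Kronecker delta. It serves to expand a value at `G r` over all domain
  -- points.
  sum-select : ∀ {n} (y : Fin n) (a : Fin n → Carrier) →
    sum (λ x → indicator (does (y Fin.≟ x)) * a x) ≈ a y
  sum-select {suc n} zero a = begin
    1# * a zero + sum (λ x → 0# * a (suc x))
      ≈⟨ +-cong (*-identityˡ _) (sum-cong-≋ (λ x → zeroˡ (a (suc x)))) ⟩
    a zero + sum {n} (λ _ → 0#)
      ≈⟨ +-congˡ (sum-replicate-zero n) ⟩
    a zero + 0#
      ≈⟨ +-identityʳ _ ⟩
    a zero ∎
  sum-select (suc y) a = begin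
    0# * a zero + sum (λ x → indicator (does (y Fin.≟ x)) * a (suc x))
      ≈⟨ +-cong (zeroˡ _) (sum-select y (a ∘ suc)) ⟩
    0# + a (suc y)
      ≈⟨ +-identityˡ _ ⟩
    a (suc y) ∎

  𝔼-cong : ∀ n {g h : Vec Bool n → Carrier} →
    (∀ r → g r ≈ h r) → 𝔼 n g ≈ 𝔼 n h
  𝔼-cong zero    g≈h = g≈h []
  𝔼-cong (suc n) g≈h = *-congˡ
    (+-cong (𝔼-cong n (g≈h ∘ (false ∷_))) (𝔼-cong n (g≈h ∘ (true ∷_))))

  𝔼-const : ∀ n x → 𝔼 n (λ _ → x) ≈ x
  𝔼-const zero    x = refl
  𝔼-const (suc n) x =
    trans (*-congˡ (+-cong (𝔼-const n x) (𝔼-const n x))) (1/2*[x+x] x)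

  𝔼-+ : ∀ n (g h : Vec Bool n → Carrier) →
    𝔼 n (λ r → g r + h r) ≈ 𝔼 n g + 𝔼 n h
  𝔼-+ zero    g h = refl
  𝔼-+ (suc n) g h = trans
    (*-congˡ (trans (+-cong (𝔼-+ n _ _) (𝔼-+ n _ _)) (+-interchange _ _ _ _)))
    (distribˡ _ _ _)

  𝔼-* : ∀ n (h : Vec Bool n → Carrier) x → 𝔼 n (λ r → h r * x) ≈ 𝔼 n h * x
  𝔼-* zero    h x = refl
  𝔼-* (suc n) h x = trans
    (*-congˡ (trans (+-cong (𝔼-* n _ x) (𝔼-* n _ x)) (sym (distribʳ x _ _))))
    (sym (*-assoc _ _ x))

  𝔼-sum : ∀ n {m} (h : Fin m → Vec Bool n → Carrier) →
    𝔼 n (λ r → sum (λ x → h x r)) ≈ sum (λ x → 𝔼 n (h x))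
  𝔼-sum n {zero}  h = 𝔼-const n 0#
  𝔼-sum n {suc m} h = trans (𝔼-+ n _ _) (+-congˡ (𝔼-sum n (h ∘ suc)))

  -- A uniform position is a uniform tape. By induction, the first bit halves the positions and
  -- `1/ (2 * 2 ^ R)` factors as `1/ 2 * 1/ (2 ^ R)`, which is the recursive clause of `𝔼`.
  average-tape : ∀ R .{{_ : NonZero (2 ℕ.^ R)}} (h : Vec Bool R → Carrier) →
    1/ (2 ℕ.^ R) * sum (λ i → h (tape i)) ≈ 𝔼 R h
  average-tape zero    h = begin
    1/ 1 * (h [] + 0#)   ≈⟨ *-cong 1/1 (+-identityʳ _) ⟩
    1# * h []            ≈⟨ *-identityˡ _ ⟩
    h []                 ∎
  average-tape (suc R) h = begin
    1/ (2 ℕ.* 2 ℕ.^ R) * sum (λ i → h (tape i))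
      ≈⟨ *-cong (1/-homo-* 2 (2 ℕ.^ R)) (begin
           sum (λ i → h (tape i))
             ≈⟨ sum-combine 2 (2 ℕ.^ R) (λ i → h (tape i)) ⟩
           sum (λ b → sum (λ j → h (tape (combine {2} {2 ℕ.^ R} b j))))
             ≈⟨ sum-cong-≋ {2} (λ b → sum-cong-≋ {2 ℕ.^ R} (λ j →
                  reflexive (cong h (tape-combine {R} b j)))) ⟩
           sum (half false) + (sum (half true) + 0#)
             ≈⟨ +-congˡ (+-identityʳ _) ⟩
           sum (half false) + sum (half true) ∎) ⟩
    1/ 2 * 1/ (2 ℕ.^ R) * (sum (half false) + sum (half true))
      ≈⟨ *-assoc _ _ _ ⟩
    1/ 2 * (1/ (2 ℕ.^ R) * (sum (half false) + sum (half true)))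
      ≈⟨ *-congˡ (distribˡ _ _ _) ⟩
    1/ 2 * (1/ (2 ℕ.^ R) * sum (half false) + 1/ (2 ℕ.^ R) * sum (half true))
      ≈⟨ *-congˡ (+-cong (average-tape R (h ∘ (false ∷_)))
                         (average-tape R (h ∘ (true ∷_)))) ⟩
    𝔼 (suc R) h ∎
    where
      instance
        2^R≢0 : NonZero (2 ℕ.^ R)
        2^R≢0 = m^n≢0 2 R

      half : Bool → Fin (2 ℕ.^ R) → Carrier
      half b j = h (b ∷ tape j)

-- Acceptance probabilities, distances and the transfer of guarantees

module VirtualVerification {c ℓ₁ ℓ₂} (𝔽 : OrderedField c ℓ₁ ℓ₂) where
  open OrderedField 𝔽
  open WeightVerification 𝔽
  open OrderedFieldProperties 𝔽
  open SumProperties 𝔽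
  open SetoidReasoning setoid
  open Sum semiring using (sum-cong-≋)

  -- For each pair of tapes exactly one of the two indicators is 1, and `𝔼` is additive and fixes
  -- constants.
  Pr[reject]≈1-Pr[accept] : ∀ {I} (o : Oracle I) V P →
    Pr[reject] o V P ≈ 1# - Pr[accept] o V P
  Pr[reject]≈1-Pr[accept] o V P = begin
    rej               ≈⟨ [x+y]-y≈x rej acc ⟨
    (rej + acc) - acc ≈⟨ +-congʳ (begin
      rej + acc
        ≈⟨ 𝔼-+ n _ _ ⟨
      𝔼 n (λ ρ → ℙ m (λ ρ′ → not (b ρ ρ′)) + ℙ m (b ρ))
        ≈⟨ 𝔼-cong n (λ ρ → sym (𝔼-+ m _ _)) ⟩
      𝔼 n (λ ρ → 𝔼 m (λ ρ′ → indicator (not (b ρ ρ′)) + indicator (b ρ ρ′)))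
        ≈⟨ 𝔼-cong n (λ ρ → 𝔼-cong m (λ ρ′ → complement (b ρ ρ′))) ⟩
      𝔼 n (λ ρ → 𝔼 m (λ ρ′ → 1#))
        ≈⟨ 𝔼-cong n (λ ρ → 𝔼-const m 1#) ⟩
      𝔼 n (λ ρ → 1#)
        ≈⟨ 𝔼-const n 1# ⟩
      1# ∎) ⟩
    1# - acc          ∎
    where
      n = Verifier.coins V
      m = Prover.coins P
      rej = Pr[reject] o V P
      acc = Pr[accept] o V P
      b : Vec Bool n → Vec Bool m → Bool
      b ρ ρ′ = Execution.accepted (run o V P ρ ρ′)

      complement : ∀ x → indicator (not x) + indicator x ≈ 1#
      complement false = +-identityʳ 1#
      complement true  = +-identityˡ 1#

  module _ {R N : ℕ} (Π : Protocol (bitString (2 ℕ.^ R)))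
           (G : Vec Bool R → Fin N) (f : Fin N → Bool) where
    open Protocol Π
    private
      module V = Protocol (virtualProtocol {R} {N} Π)

    Pr[accept]-informed : ∀ P →
      Pr[accept] (virtualString G f) verifier (informedProver G f P) ≈
      Pr[accept] (grayBoxOracle G f) V.verifier P
    Pr[accept]-informed P = 𝔼-cong _ λ ρ → 𝔼-cong _ λ ρ′ → reflexive
      (cong (indicator ∘ Execution.accepted) (≡.sym
        (runTree-informed G f P (Prover.start P ρ′) (Verifier.tree verifier ρ))))

    Pr[accept]-honest :
      Pr[accept] (virtualString G f) verifier honest ≈
      Pr[accept] (grayBoxOracle G f) V.verifier V.honest
    Pr[accept]-honest = 𝔼-cong _ λ ρ → 𝔼-cong _ λ ρ′ → reflexive
      (cong (indicator ∘ Execution.accepted) (≡.sym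
        (runTree-honest G f Π (Prover.start honest ρ′) (Verifier.tree verifier ρ))))

  module _ {R N : ℕ} .{{_ : NonZero (2 ℕ.^ R)}} (i : GrayBoxInstance R N) where
    open GrayBoxInstance i

    -- The weight is the average of f(G(r)) over tapes. Expanding it over the value x of G(r) and
    -- exchanging expectation and sum leaves the probability of each x, which `samples` identifies
    -- with its mass.
    wt-virtualString : wt (2 ℕ.^ R) (virtualString G f) ≈ wtᴰ D f
    wt-virtualString = begin
      wt (2 ℕ.^ R) (virtualString G f)
        ≈⟨ average-tape R (λ r → indicator (f (G r))) ⟩
      𝔼 R (λ r → indicator (f (G r)))
        ≈⟨ 𝔼-cong R (λ r → sum-select (G r) (indicator ∘ f)) ⟨
      𝔼 R (λ r → sum (λ x → indicator (does (G r Fin.≟ x)) * indicator (f x)))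
        ≈⟨ 𝔼-sum R (λ x r → indicator (does (G r Fin.≟ x)) * indicator (f x)) ⟩
      sum (λ x → 𝔼 R (λ r → indicator (does (G r Fin.≟ x)) * indicator (f x)))
        ≈⟨ sum-cong-≋ (λ x → trans (𝔼-* R _ _) (*-congʳ (samples x))) ⟩
      wtᴰ D f ∎

    Δ-virtual : ∀ σ →
      Problem.Δ (HW (2 ℕ.^ R)) (lift (virtualString G f)) σ ≈
      Problem.Δ (dwHW R N) i σ
    Δ-virtual σ = ∣∣-cong (+-congʳ wt-virtualString)

  virtual-complete : ∀ R N ε (Π : Claim → Protocol (bitString (2 ℕ.^ R)))
    .{{_ : NonZero (2 ℕ.^ R)}} a → AcceptsCloseWithProb≥ (HW (2 ℕ.^ R)) ε Π a →
    AcceptsCloseWithProb≥ (dwHW R N) ε (virtualProtocol ∘ Π) a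
  virtual-complete R N ε Π a complete i σ close = ≤-trans
    (complete (lift (virtualString G f)) σ
      (≤-trans (≤-reflexive (Δ-virtual i σ)) close))
    (≤-reflexive (Pr[accept]-honest (Π σ) G f))
    where open GrayBoxInstance i

  -- String soundness quantifies over provers after fixing the string, so it applies to
  -- `informedProver G f P` although that prover depends on `G` and `f`.
  virtual-sound : ∀ R N ε (Π : Claim → Protocol (bitString (2 ℕ.^ R)))
    .{{_ : NonZero (2 ℕ.^ R)}} e → SoundnessError≤ (HW (2 ℕ.^ R)) ε Π e →
    SoundnessError≤ (dwHW R N) ε (virtualProtocol ∘ Π) e
  virtual-sound R N ε Π e sound i σ far P = ≤-trans
    (≤-reflexive (sym (Pr[accept]-informed (Π σ) G f P)))
    (sound (lift (virtualString G f)) σ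
      (<-respʳ-≈ (sym (Δ-virtual i σ)) far) (informedProver G f P))
    where open GrayBoxInstance i

  acceptance⇒completeness : ∀ {I} (𝒫 : Problem I) ε Π e →
    AcceptsCloseWithProb≥ 𝒫 ε Π (1# - e) → CompletenessError≤ 𝒫 ε Π e
  acceptance⇒completeness 𝒫 ε Π e complete i σ close = ≤-trans
    (≤-reflexive (Pr[reject]≈1-Pr[accept] (Problem.oracle 𝒫 i)
      (Protocol.verifier (Π σ)) (Protocol.honest (Π σ))))
    (x-y≤z⇒x-z≤y (complete i σ close))

  ΠGBWM-tolerant : ∀ Π → IsTolerantFamily Π → ∀ R N ε d →
    IsTolerant (dwHW R N) ε (ΠGBWM Π R N ε d) d
  ΠGBWM-tolerant Π tolerant R N ε d =
    let complete , sound = tolerant (2 ℕ.^ R) ε d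
    in virtual-complete R N ε (Π (2 ℕ.^ R) ε d) _ complete
     , virtual-sound R N ε (Π (2 ℕ.^ R) ε d) _ sound
    where
      instance
        2^R≢0 : NonZero (2 ℕ.^ R)
        2^R≢0 = m^n≢0 2 R

  -- The virtual string has length `2 ^ R`, whose logarithm is exactly `R`. Hence O(log n) becomes
  -- O(R) with the same constants `C` and `k`.
  ΠGBWM-bounded : ∀ bounds Π d →
    StringBounded bounds Π d → GrayBoxBounded bounds Π d
  ΠGBWM-bounded bounds Π d (C , k , within) = C , k , λ R N ε σ →
    virtualProtocol-within (bounds C k ε R) _
      (subst (λ s → StringWithin (bounds C k ε s) (Π (2 ℕ.^ R) ε d σ))
        (⌈log₂2^n⌉≡n R) (within (2 ℕ.^ R) {{m^n≢0 2 R}} ε σ))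

theorem4p11 : ∀ {c ℓ₁ ℓ₂ p : Level} (𝔽 : OrderedField c ℓ₁ ℓ₂) →
    let open OrderedField 𝔽 in
    let open WeightVerification 𝔽 in
    (Π : StringFamily) → IsTolerantFamily Π →
    (∀ R N ε d →
    CompletenessError≤ (dwHW R N) ε (ΠGBWM Π R N ε d) (ErrorParameter.2δ d)
    × SoundnessError≤ (dwHW R N) ε (ΠGBWM Π R N ε d) (ErrorParameter.2δ d))
    × (∀ R N ε d → ErrorParameter.δ d ≤ 1/ 6 →
    IsInteractiveProof (dwHW R N) ε (ΠGBWM Π R N ε d))
    × (∀ d → StringBounded logRoundBounds Π d → GrayBoxBounded logRoundBounds Π d)
    × (∀ d → StringBounded oneRoundBounds Π d → GrayBoxBounded oneRoundBounds Π d)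
    × (∀ (bounds : ℕ → Radii → Bounds p) d →
    (∀ n .{{_ : NonZero n}} ε σ → StringWithin (bounds n ε) (Π n ε d σ)) →
    ∀ R N ε σ → GrayBoxWithin (bounds (2 ℕ.^ R) ε) (ΠGBWM Π R N ε d σ))
theorem4p11 𝔽 Π tolerant =
    (λ R N ε d →
      let complete , sound = ΠGBWM-tolerant Π tolerant R N ε d
      in acceptance⇒completeness (dwHW R N) ε (ΠGBWM Π R N ε d) _ complete , sound)
  , (λ R N ε d δ≤1/6 →
      let complete , sound = ΠGBWM-tolerant Π tolerant R N ε d
          2δ≤1/3 = x≤1/6⇒2x≤1/3 δ≤1/6
      in (λ i σ close → ≤-trans (y≤1/3⇒2/3≤1-y 2δ≤1/3) (complete i σ close))
       , (λ i σ far P → ≤-trans (sound i σ far P) 2δ≤1/3))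
  , ΠGBWM-bounded logRoundBounds Π
  , ΠGBWM-bounded oneRoundBounds Π
  -- For an arbitrary trade-off the bound stays a function of the length, evaluated at `2 ^ R`.
  , (λ bounds d within R N ε σ → virtualProtocol-within (bounds (2 ℕ.^ R) ε) _
      (within (2 ℕ.^ R) {{m^n≢0 2 R}} ε σ))
  where
    open OrderedField 𝔽
    open WeightVerification 𝔽
    open OrderedFieldProperties 𝔽
    open VirtualVerification 𝔽
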